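{- Let $X$ and $Y$ be formulas of classical propositional logic such that $\models X \to Y$. Then $X$ and $Y$ have an (extended) interpolant. That is, let $\mathcal{X}$ be a finite set of clauses and $\mathcal{Y}$ a finite set of complements of clauses such that $\bigwedge\mathcal{X}$ is a conjunctive normal form of $X$ and $\bigvee\mathcal{Y}$ is a disjunctive normal form of $Y$ (so $\models X \equiv \bigwedge\mathcal{X}$ and $\models Y \equiv \bigvee\mathcal{Y}$). Then there is a formula $I$ such that (1) $\models X \to I$ and $\models I \to Y$; and (2) if there is a literal $l$ such that $l$ and its complement $l^*$ occur in different clauses of $\mathcal{X}\cup\mathcal{Y}^*$, then every propositional variable occurring in $I$ occurs in both $X$ and $Y$.
   Context: Formulas are built from propositional variables and the two constants $\bot$ (falsum) and $\top$ (verum) using $\neg,\wedge,\vee,\rightarrow,\equiv$. The constants are atomic formulas and are not propositional variables. A valuation assigns $0$ or $1$ to each propositional variable, with $\bot$ always $0$ and $\top$ always $1$, and is extended to all formulas by the classical truth tables. We write $\models A$ ($A$ is valid) if every valuation gives $A$ the value $1$. A literal is a propositional variable $p$ or its negation $\neg p$. The complement $l^*$ of a literal $l$ is $\neg p$ if $l=p$, and $p$ if $l=\neg p$. For a finite set $\mathcal{S}$ of formulas, $\bigwedge\mathcal{S}$ and $\bigvee\mathcal{S}$ denote the conjunction and disjunction of its elements, with $\bigwedge\emptyset=\top$ and $\bigvee\emptyset=\bot$. A clause is a formula $\bigvee\mathcal{S}$ with $\mathcal{S}$ a finite (possibly empty) set of literals. The complement of the clause $\bigvee\mathcal{S}$ is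 $\bigwedge\mathcal{S}^*$, where $\mathcal{S}^*=\{l^*: l\in\mathcal{S}\}$. Likewise the complement of $\bigwedge\mathcal{S}$ is $\bigvee\mathcal{S}^*$. A conjunctive normal form (CNF) is a conjunction of clauses, and a disjunctive normal form (DNF) is a disjunction of complements of clauses. Every formula is equivalent to a CNF and to a DNF. For a set $\mathcal{Y}$ of complements of clauses, $\mathcal{Y}^*$ denotes the set of the complements of the elements of $\mathcal{Y}$, so it is a set of clauses. A formula $I$ is called an (extended) interpolant of $X$ and $Y$, where $X$ is represented by the CNF $\bigwedge\mathcal{X}$ and $Y$ by the DNF $\bigvee\mathcal{Y}$, if conditions (1) and (2) of the claim hold. It is not required that $X$ and $Y$ share a propositional variable. -}

module Defs where

open import Level using (Level)
open import Data.Bool.Base using (Bool; true; false; not; _∧_; _∨_)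
open import Data.List.Base using (List; []; _∷_; [_]; _++_; map)
open import Data.List.Membership.Propositional using (_∈_)
open import Data.List.Relation.Binary.BagAndSetEquality using (_∼[_]_; set)
open import Data.Product.Base using (_×_; ∃-syntax)
open import Relation.Binary.PropositionalEquality.Core using (_≡_)
open import Relation.Nullary.Negation.Core using (¬_)

private
  variable
    a : Level
    Var : Set a

infix  9 ¬ᶠ_
infixr 8 _∧ᶠ_
infixr 7 _∨ᶠ_
infixr 6 _→ᶠ_
infix  5 _≡ᶠ_

data Formula (Var : Set a) : Set a where
  var  : Var → Formula Var
  ⊥ᶠ   : Formula Var
  ⊤ᶠ   : Formula Var
  ¬ᶠ_  : Formula Var → Formula Var
  _∧ᶠ_ : Formula Var → Formula Var → Formula Var
  _∨ᶠ_ : Formula Var → Formula Var → Formula Var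
  _→ᶠ_ : Formula Var → Formula Var → Formula Var
  _≡ᶠ_ : Formula Var → Formula Var → Formula Var

vars : Formula Var → List Var
vars (var p)  = [ p ]
vars ⊥ᶠ       = []
vars ⊤ᶠ       = []
vars (¬ᶠ A)   = vars A
vars (A ∧ᶠ B) = vars A ++ vars B
vars (A ∨ᶠ B) = vars A ++ vars B
vars (A →ᶠ B) = vars A ++ vars B
vars (A ≡ᶠ B) = vars A ++ vars B

infix 4 _occursIn_

_occursIn_ : {Var : Set a} → Var → Formula Var → Set a
p occursIn A = p ∈ vars A

Valuation : Set a → Set a
Valuation Var = Var → Bool

impᵇ : Bool → Bool → Bool
impᵇ true  b = b
impᵇ false b = true

iffᵇ : Bool → Bool → Bool
iffᵇ true  b = b
iffᵇ false b = not b

⟦_⟧ : Formula Var → Valuation Var → Bool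
⟦ var p  ⟧ v = v p
⟦ ⊥ᶠ     ⟧ v = false
⟦ ⊤ᶠ     ⟧ v = true
⟦ ¬ᶠ A   ⟧ v = not (⟦ A ⟧ v)
⟦ A ∧ᶠ B ⟧ v = ⟦ A ⟧ v ∧ ⟦ B ⟧ v
⟦ A ∨ᶠ B ⟧ v = ⟦ A ⟧ v ∨ ⟦ B ⟧ v
⟦ A →ᶠ B ⟧ v = impᵇ (⟦ A ⟧ v) (⟦ B ⟧ v)
⟦ A ≡ᶠ B ⟧ v = iffᵇ (⟦ A ⟧ v) (⟦ B ⟧ v)

infix 3 ⊨_

⊨_ : {Var : Set a} → Formula Var → Set a
⊨ A = ∀ v → ⟦ A ⟧ v ≡ true

data Literal (Var : Set a) : Set a where
  pos neg : Var → Literal Var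

infix 10 _*

_* : Literal Var → Literal Var
pos p * = neg p
neg p * = pos p

literalFormula : Literal Var → Formula Var
literalFormula (pos p) = var p
literalFormula (neg p) = ¬ᶠ (var p)

-- Finite sets are given by lists enumerating their elements.

⋀ : List (Formula Var) → Formula Var
⋀ []           = ⊤ᶠ
⋀ (A ∷ [])     = A
⋀ (A ∷ B ∷ Bs) = A ∧ᶠ ⋀ (B ∷ Bs)

⋁ : List (Formula Var) → Formula Var
⋁ []           = ⊥ᶠ
⋁ (A ∷ [])     = A
⋁ (A ∷ B ∷ Bs) = A ∨ᶠ ⋁ (B ∷ Bs)

-- `disj S` stands for the clause ⋁ S, and `conj S` for the complement ⋀ S of
-- a clause.

record Clause (Var : Set a) : Set a where
  constructor disj
  field
    literals : List (Literal Var)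

record CoClause (Var : Set a) : Set a where
  constructor conj
  field
    literals : List (Literal Var)

clauseFormula : Clause Var → Formula Var
clauseFormula (disj S) = ⋁ (map literalFormula S)

coClauseFormula : CoClause Var → Formula Var
coClauseFormula (conj S) = ⋀ (map literalFormula S)

complement : CoClause Var → Clause Var
complement (conj S) = disj (map _* S)

infix 4 _∈ᶜ_ _≉_

_∈ᶜ_ : {Var : Set a} → Literal Var → Clause Var → Set a
l ∈ᶜ C = l ∈ Clause.literals C

-- Clauses are compared as sets of literals: listing the same literals in
-- another order or with repetitions does not give a different clause.

_≉_ : {Var : Set a} → Clause Var → Clause Var → Set a
C ≉ D = ¬ (Clause.literals C ∼[ set ] Clause.literals D)

CNF : {Var : Set a} → List (Clause Var) → Formula Var
CNF 𝒳 = ⋀ (map clauseFormula 𝒳)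

DNF : {Var : Set a} → List (CoClause Var) → Formula Var
DNF 𝒴 = ⋁ (map coClauseFormula 𝒴)

HasComplementaryLiterals : {Var : Set a} → List (Clause Var) → Set a
HasComplementaryLiterals 𝒞 =
  ∃[ l ] ∃[ C ] ∃[ D ] C ∈ 𝒞 × D ∈ 𝒞 × C ≉ D × l ∈ᶜ C × l * ∈ᶜ D

record IsInterpolant {Var : Set a} (X Y : Formula Var)
                     (𝒳 : List (Clause Var)) (𝒴 : List (CoClause Var))
                     (I : Formula Var) : Set a where
  field
    fromX  : ⊨ X →ᶠ I
    toY    : ⊨ I →ᶠ Y
    common : HasComplementaryLiterals (𝒳 ++ map complement 𝒴) →
             ∀ p → p occursIn I → p occursIn X × p occursIn Y

{-# OPTIONS --safe #-}

-- Existentially quantify away, in X, every variable that does not occur in Y,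
-- where ∃p.A is A[⊤/p] ∨ A[⊥/p]: the result is the strongest consequence of X
-- in the common variables, and ⊥, ⊤ bring in no variable of their own.

module Submission where

open import Data.Bool.Base using (Bool; true; false; not; _∧_; _∨_)
open import Data.Bool.Properties using (∨-zeroʳ)
open import Data.List.Base using (List; []; _∷_; _++_; concatMap; foldr; filter)
open import Data.List.Membership.Propositional using (_∈_; _∉_; find)
open import Data.List.Membership.Propositional.Properties
  using (∈-++⁺ˡ; ∈-++⁺ʳ; ∈-++⁻; ∈-concatMap⁻; ∈-filter⁺; ∈-filter⁻)
open import Data.List.Properties using (concatMap-++; ++-identityʳ)
open import Data.List.Relation.Unary.All using (All; []; _∷_; tabulate)
open import Data.List.Relation.Unary.Any using (here; there)
import Data.List.Membership.DecPropositional as DecMembership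
open import Data.Product.Base using (_×_; _,_; proj₂; ∃-syntax)
open import Data.Sum.Base using ([_,_]′)
open import Function.Base using (_∘_)
open import Relation.Binary.Definitions using (DecidableEquality)
open import Relation.Binary.PropositionalEquality
  using (_≡_; _≢_; refl; sym; trans; cong; cong₂; subst; module ≡-Reasoning)
open import Relation.Nullary.Decidable using (yes; no; ¬?; decidable-stable)
open import Relation.Nullary.Negation using (contradiction)
open import Defs

module _ {a} {Var : Set a} where

  →ᶠ-intro : (A B : Formula Var) →
    (∀ v → ⟦ A ⟧ v ≡ true → ⟦ B ⟧ v ≡ true) → ⊨ A →ᶠ B
  →ᶠ-intro A B A⇒B v with ⟦ A ⟧ v in A≡
  ... | true  = A⇒B v A≡
  ... | false = refl

  →ᶠ-elim : (A B : Formula Var) →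
    ⊨ A →ᶠ B → ∀ v → ⟦ A ⟧ v ≡ true → ⟦ B ⟧ v ≡ true
  →ᶠ-elim A B ⊨A→B v A≡ = trans (cong (λ b → impᵇ b (⟦ B ⟧ v)) (sym A≡)) (⊨A→B v)

  ⟦⟧-local : (A : Formula Var) {v w : Valuation Var} →
    (∀ q → q occursIn A → v q ≡ w q) → ⟦ A ⟧ v ≡ ⟦ A ⟧ w
  -- The binary connectives differ only in their truth function, so a single step, mutually
  -- recursive with `⟦⟧-local`, covers all four.
  ⟦⟧-local₂ : (_⊕_ : Bool → Bool → Bool) (A B : Formula Var) {v w : Valuation Var} →
    (∀ q → q ∈ vars A ++ vars B → v q ≡ w q) →
    ⟦ A ⟧ v ⊕ ⟦ B ⟧ v ≡ ⟦ A ⟧ w ⊕ ⟦ B ⟧ w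

  ⟦⟧-local (var p)  v≈w = v≈w p (here refl)
  ⟦⟧-local ⊥ᶠ       v≈w = refl
  ⟦⟧-local ⊤ᶠ       v≈w = refl
  ⟦⟧-local (¬ᶠ A)   v≈w = cong not (⟦⟧-local A v≈w)
  ⟦⟧-local (A ∧ᶠ B) v≈w = ⟦⟧-local₂ _∧_ A B v≈w
  ⟦⟧-local (A ∨ᶠ B) v≈w = ⟦⟧-local₂ _∨_ A B v≈w
  ⟦⟧-local (A →ᶠ B) v≈w = ⟦⟧-local₂ impᵇ A B v≈w
  ⟦⟧-local (A ≡ᶠ B) v≈w = ⟦⟧-local₂ iffᵇ A B v≈w

  ⟦⟧-local₂ _⊕_ A B v≈w = cong₂ _⊕_
    (⟦⟧-local A λ q q∈A → v≈w q (∈-++⁺ˡ q∈A))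
    (⟦⟧-local B λ q q∈B → v≈w q (∈-++⁺ʳ (vars A) q∈B))

  -- Simultaneous substitution, the monadic bind of `Formula`.
  bind : (Var → Formula Var) → Formula Var → Formula Var
  bind σ (var p)  = σ p
  bind σ ⊥ᶠ       = ⊥ᶠ
  bind σ ⊤ᶠ       = ⊤ᶠ
  bind σ (¬ᶠ A)   = ¬ᶠ bind σ A
  bind σ (A ∧ᶠ B) = bind σ A ∧ᶠ bind σ B
  bind σ (A ∨ᶠ B) = bind σ A ∨ᶠ bind σ B
  bind σ (A →ᶠ B) = bind σ A →ᶠ bind σ B
  bind σ (A ≡ᶠ B) = bind σ A ≡ᶠ bind σ B

  ⟦bind⟧ : ∀ σ A (v : Valuation Var) → ⟦ bind σ A ⟧ v ≡ ⟦ A ⟧ (λ q → ⟦ σ q ⟧ v)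
  ⟦bind⟧ σ (var p)  v = refl
  ⟦bind⟧ σ ⊥ᶠ       v = refl
  ⟦bind⟧ σ ⊤ᶠ       v = refl
  ⟦bind⟧ σ (¬ᶠ A)   v = cong not (⟦bind⟧ σ A v)
  ⟦bind⟧ σ (A ∧ᶠ B) v = cong₂ _∧_ (⟦bind⟧ σ A v) (⟦bind⟧ σ B v)
  ⟦bind⟧ σ (A ∨ᶠ B) v = cong₂ _∨_ (⟦bind⟧ σ A v) (⟦bind⟧ σ B v)
  ⟦bind⟧ σ (A →ᶠ B) v = cong₂ impᵇ (⟦bind⟧ σ A v) (⟦bind⟧ σ B v)
  ⟦bind⟧ σ (A ≡ᶠ B) v = cong₂ iffᵇ (⟦bind⟧ σ A v) (⟦bind⟧ σ B v)

  -- Keeping this an equality of lists makes the induction rest only on `concatMap` distributing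
  -- over `++`; membership is extracted afterwards.
  vars-bind : ∀ σ (A : Formula Var) → vars (bind σ A) ≡ concatMap (vars ∘ σ) (vars A)
  vars-bind₂ : ∀ σ (A B : Formula Var) →
    vars (bind σ A) ++ vars (bind σ B) ≡ concatMap (vars ∘ σ) (vars A ++ vars B)

  vars-bind σ (var p)  = sym (++-identityʳ (vars (σ p)))
  vars-bind σ ⊥ᶠ       = refl
  vars-bind σ ⊤ᶠ       = refl
  vars-bind σ (¬ᶠ A)   = vars-bind σ A
  vars-bind σ (A ∧ᶠ B) = vars-bind₂ σ A B
  vars-bind σ (A ∨ᶠ B) = vars-bind₂ σ A B
  vars-bind σ (A →ᶠ B) = vars-bind₂ σ A B
  vars-bind σ (A ≡ᶠ B) = vars-bind₂ σ A B

  vars-bind₂ σ A B = trans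
    (cong₂ _++_ (vars-bind σ A) (vars-bind σ B))
    (sym (concatMap-++ (vars ∘ σ) (vars A) (vars B)))

module Elimination {a} {Var : Set a} (_≟_ : DecidableEquality Var) where

  constant : Bool → Formula Var
  constant true  = ⊤ᶠ
  constant false = ⊥ᶠ

  ⟦constant⟧ : ∀ b v → ⟦ constant b ⟧ v ≡ b
  ⟦constant⟧ true  v = refl
  ⟦constant⟧ false v = refl

  ∉vars-constant : ∀ b {q} → q ∉ vars (constant b)
  ∉vars-constant true  ()
  ∉vars-constant false ()

  _↦_ : Var → Bool → Var → Formula Var
  (p ↦ b) q with q ≟ p
  ... | yes _ = constant b
  ... | no  _ = var q

  ∃ᶠ : Var → Formula Var → Formula Var
  ∃ᶠ p A = bind (p ↦ true) A ∨ᶠ bind (p ↦ false) A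

  ⟦↦⟧-self : ∀ p v q → ⟦ (p ↦ v p) q ⟧ v ≡ v q
  ⟦↦⟧-self p v q with q ≟ p
  ... | yes refl = ⟦constant⟧ (v q) v
  ... | no  _    = refl

  ⟦↦⟧-other : ∀ p b v {q} → q ≢ p → ⟦ (p ↦ b) q ⟧ v ≡ v q
  ⟦↦⟧-other p b v {q} q≢p with q ≟ p
  ... | yes q≡p = contradiction q≡p q≢p
  ... | no  _   = refl

  vars-↦ : ∀ p b q {r} → r ∈ vars ((p ↦ b) q) → r ≡ q × r ≢ p
  vars-↦ p b q r∈ with q ≟ p
  ... | yes _ = contradiction r∈ (∉vars-constant b)
  vars-↦ p b q (here refl) | no q≢p = refl , q≢p

  vars-bind-↦ : ∀ p b A {r} → r occursIn bind (p ↦ b) A → r occursIn A × r ≢ p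
  vars-bind-↦ p b A r∈
    with find (∈-concatMap⁻ (vars ∘ (p ↦ b)) (subst (_ ∈_) (vars-bind (p ↦ b) A) r∈))
  -- The occurrence of `r` comes from the image of some `q` in `A`. Constants contain no variable,
  -- so `q` was left in place and is `r` itself.
  ... | q , q∈A , r∈q with vars-↦ p b q r∈q
  ...   | refl , r≢p = q∈A , r≢p

  vars-∃ᶠ : ∀ p A {r} → r occursIn ∃ᶠ p A → r occursIn A × r ≢ p
  vars-∃ᶠ p A =
    [ vars-bind-↦ p true A , vars-bind-↦ p false A ]′ ∘ ∈-++⁻ (vars (bind (p ↦ true) A))

  ∃ᶠ-intro : ∀ p A v → ⟦ A ⟧ v ≡ true → ⟦ ∃ᶠ p A ⟧ v ≡ true
  -- The true disjunct is the one that replaces `p` by the value `v` already gives it, since this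
  -- substitution leaves the valuation unchanged.
  ∃ᶠ-intro p A v A≡ = select (v p) (begin
    ⟦ bind (p ↦ v p) A ⟧ v           ≡⟨ ⟦bind⟧ (p ↦ v p) A v ⟩
    ⟦ A ⟧ (λ q → ⟦ (p ↦ v p) q ⟧ v)  ≡⟨ ⟦⟧-local A (λ q _ → ⟦↦⟧-self p v q) ⟩
    ⟦ A ⟧ v                          ≡⟨ A≡ ⟩
    true                             ∎)
    where
    open ≡-Reasoning
    select : ∀ b → ⟦ bind (p ↦ b) A ⟧ v ≡ true → ⟦ ∃ᶠ p A ⟧ v ≡ true
    select true  eq rewrite eq = refl
    select false eq rewrite eq = ∨-zeroʳ _

  -- A true disjunct says that `A` holds at `v` with the value of `p` reset. The implication is
  -- applied at that valuation, and `B`, in which `p` does not occur, takes the same value back at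
  -- `v`.
  ∃ᶠ-elim : ∀ p A B → p ∉ vars B →
    (∀ v → ⟦ A ⟧ v ≡ true → ⟦ B ⟧ v ≡ true) →
    ∀ v → ⟦ ∃ᶠ p A ⟧ v ≡ true → ⟦ B ⟧ v ≡ true
  ∃ᶠ-elim p A B p∉B A⇒B v ∃A≡ = split (⟦ bind (p ↦ true) A ⟧ v) refl
    where
    instantiate : ∀ b → ⟦ bind (p ↦ b) A ⟧ v ≡ true → ⟦ B ⟧ v ≡ true
    instantiate b eq = trans
      (sym (⟦⟧-local B λ q q∈B → ⟦↦⟧-other p b v λ { refl → p∉B q∈B }))
      (A⇒B _ (trans (sym (⟦bind⟧ (p ↦ b) A v)) eq))

    split : ∀ c → ⟦ bind (p ↦ true) A ⟧ v ≡ c → ⟦ B ⟧ v ≡ true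
    split true  eq = instantiate true eq
    -- With the first disjunct false, the disjunction computes to the second.
    split false eq = instantiate false
      (trans (cong (_∨ ⟦ bind (p ↦ false) A ⟧ v) (sym eq)) ∃A≡)

  ∃ᶠ* : List Var → Formula Var → Formula Var
  ∃ᶠ* ps A = foldr ∃ᶠ A ps

  ∃ᶠ*-intro : ∀ ps A v → ⟦ A ⟧ v ≡ true → ⟦ ∃ᶠ* ps A ⟧ v ≡ true
  ∃ᶠ*-intro []       A v A≡ = A≡
  ∃ᶠ*-intro (p ∷ ps) A v A≡ = ∃ᶠ-intro p (∃ᶠ* ps A) v (∃ᶠ*-intro ps A v A≡)

  -- The implication is assumed at all valuations because each elimination step uses it at a
  -- modified one; the conclusion has the same shape, so the steps chain.
  ∃ᶠ*-elim : ∀ {ps} A B → All (_∉ vars B) ps →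
    (∀ v → ⟦ A ⟧ v ≡ true → ⟦ B ⟧ v ≡ true) →
    ∀ v → ⟦ ∃ᶠ* ps A ⟧ v ≡ true → ⟦ B ⟧ v ≡ true
  ∃ᶠ*-elim          A B []           A⇒B = A⇒B
  ∃ᶠ*-elim {p ∷ ps} A B (p∉B ∷ ps∉B) A⇒B =
    ∃ᶠ-elim p (∃ᶠ* ps A) B p∉B (∃ᶠ*-elim A B ps∉B A⇒B)

  -- Outer quantifiers only remove variables, so none eliminated further inside can reappear.
  vars-∃ᶠ* : ∀ ps A {r} → r occursIn ∃ᶠ* ps A → r occursIn A × r ∉ ps
  vars-∃ᶠ* []       A r∈ = r∈ , λ ()
  vars-∃ᶠ* (p ∷ ps) A r∈ with vars-∃ᶠ p (∃ᶠ* ps A) r∈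
  ... | r∈ps , r≢p with vars-∃ᶠ* ps A r∈ps
  ...   | r∈A , r∉ps = r∈A , λ { (here r≡p) → r≢p r≡p ; (there r∈ps) → r∉ps r∈ps }

mainTheorem1 : ∀ {a} {Var : Set a} → DecidableEquality Var →
    (X Y : Formula Var) → ⊨ X →ᶠ Y →
    (𝒳 : List (Clause Var)) (𝒴 : List (CoClause Var)) →
    ⊨ X ≡ᶠ CNF 𝒳 → ⊨ Y ≡ᶠ DNF 𝒴 →
    ∃[ I ] IsInterpolant X Y 𝒳 𝒴 I
mainTheorem1 {Var = Var} _≟_ X Y ⊨X→Y 𝒳 𝒴 _ _ = I , record
  { fromX  = →ᶠ-intro X I (∃ᶠ*-intro ps X)
  ; toY    = →ᶠ-intro I Y
      -- Every quantified variable passed the filter, hence is absent from `Y`, as elimination into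
      -- `Y` demands.
      (∃ᶠ*-elim X Y (tabulate (proj₂ ∘ ∈-filter⁻ ∉Y? {xs = vars X})) (→ᶠ-elim X Y ⊨X→Y))
  -- A variable of `X` missing from `Y` would lie in `ps` and so be gone from `I`; decidable
  -- membership turns this refutation into an occurrence in `Y`.
  ; common = λ _ p p∈I → let p∈X , p∉ps = vars-∃ᶠ* ps X p∈I in
      p∈X , decidable-stable (p ∈? vars Y) (p∉ps ∘ ∈-filter⁺ ∉Y? p∈X)
  }
  where
  open Elimination _≟_
  open DecMembership _≟_ using (_∈?_)
  ∉Y? = λ p → ¬? (p ∈? vars Y)
  ps : List Var
  ps = filter ∉Y? (vars X)
  I : Formula Var
  I = ∃ᶠ* ps X
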